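{- Let $x=(x_1,x_2,\dots,x_n)$ be a binary sequence of length $n>33$ with $x_1=1$ whose first $33$ elements have run length encoding $(5,5,10,5,4,4)$. Put $p=5$, $t=16$, and $z_j=x_{p(j-1)+1}$, so that $z=(1,-1,1,1,-1,1,-1,\dots)$. Then $x_i=1$ for $1\le i\le p$, $x_{p+1}=-1$, and $x$ satisfies equation $(k)$ for all $1\le k\le t=16$, but $z$ does not satisfy equation $(k)$ for $k=3$, although $3\le\frac{t}{p}=3.2$.
   Context: A binary sequence of length $n$ is $x=(x_1,\dots,x_n)$ with each $x_i\in\{ -1,1\}$. For $1\le k<\frac{n-1}{2}$, the sequence $x$ is said to satisfy equation $(k)$ if $$\frac{1+(-1)^{k+1}}{2}=\sum_{i=1}^{k}(-1)^{i+1}x_i x_{2k+2-i}.$$ Whether equation $(k)$ holds depends only on the first $2k+1$ elements of the sequence, so for the sequence $z$ the equation $(k)$ is to be read as this identity with $z_1,\dots,z_{2k+1}$ in place of $x_1,\dots,x_{2k+1}$. The run length encoding of a finite sequence is the list of the lengths of its successive maximal blocks of equal consecutive elements. -}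

module Defs where

open import Level using (Level)
open import Data.Fin using (Fin; toℕ; fromℕ<)
open import Data.Fin.Properties using (toℕ<n)
open import Data.Integer using (ℤ; 1ℤ; -1ℤ)
import Data.Integer as ℤ
import Data.Integer.Properties as ℤₚ
open import Algebra.Properties.CommutativeMonoid.Sum ℤₚ.+-0-commutativeMonoid using (sum)
open import Data.List using (List; []; _∷_)
open import Data.Nat
open import Data.Nat.DivMod using (m/n*n≤m)
open import Data.Nat.Properties
import Data.Rational as ℚ
open import Data.Sum using (_⊎_)
open import Data.Vec using (Vec; lookup; tabulate)
open import Data.Vec.Relation.Unary.All using (All)
open import Relation.Binary.Definitions using (DecidableEquality)
open import Relation.Binary.PropositionalEquality using (_≡_; sym)
open import Relation.Nullary using (yes; no)

private
  variable
    a : Level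
    A : Set a
    m n : ℕ

Binary : Vec ℤ n → Set
Binary = All (λ v → (v ≡ -1ℤ) ⊎ (v ≡ 1ℤ))

-- Sequences are indexed from 1.
entry : Vec A n → (i : ℕ) .{{_ : NonZero i}} → .(i ≤ n) → A
entry x (suc i) i<n = lookup x (fromℕ< i<n)

-- The summation index i runs over 1, …, k as suc (toℕ j) for j : Fin k.
-- The bound says that y₁, …, y₂ₖ₊₁ all exist.  It is weaker than
-- k < (n - 1)/2, so that the equation also makes sense for a sequence of
-- length exactly 2k + 1.
SatisfiesEquation : Vec ℤ m → (k : ℕ) → .(2 * k + 1 ≤ m) → Set
SatisfiesEquation {m = m} y k 2k+1≤m =
  (1ℤ ℤ.+ -1ℤ ℤ.^ (k + 1)) ℚ./ 2 ≡ sum term ℚ./ 1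
  where
  i≤k : (j : Fin k) → suc (toℕ j) ≤ k
  i≤k = toℕ<n

  i<2k+2 : (j : Fin k) → suc (toℕ j) < 2 * k + 2
  i<2k+2 j = ≤-<-trans (≤-trans (i≤k j) (m≤m+n k _)) (m<m+n (2 * k) (s≤s z≤n))

  i≤m : (j : Fin k) → 2 * k + 1 ≤ m → suc (toℕ j) ≤ m
  i≤m j h = ≤-trans (≤-trans (i≤k j) (≤-trans (m≤m+n k _) (m≤m+n (2 * k) 1))) h

  2k+2∸i≤m : (j : Fin k) → 2 * k + 1 ≤ m → 2 * k + 2 ∸ suc (toℕ j) ≤ m
  2k+2∸i≤m j h = ≤-trans (∸-monoʳ-≤ (2 * k + 2) (s≤s (z≤n {toℕ j})))
                 (≤-trans (≤-reflexive (+-∸-assoc (2 * k) {2} {1} (s≤s z≤n))) h)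

  term : Fin k → ℤ
  term j =
    let i = suc (toℕ j) in
    -1ℤ ℤ.^ (i + 1)
      ℤ.* entry y i (i≤m j 2k+1≤m)
      ℤ.* entry y (2 * k + 2 ∸ i) {{>-nonZero (m<n⇒0<n∸m (i<2k+2 j))}} (2k+2∸i≤m j 2k+1≤m)

⌈_/_⌉ : (n p : ℕ) .{{_ : NonZero p}} → ℕ
⌈ n / p ⌉ = (n + (p ∸ 1)) / p

-- z_j = x_{p(j-1)+1} for all j with p(j-1)+1 ≤ n, that is 1 ≤ j ≤ ⌈ n / p ⌉.
-- Here j - 1 is toℕ j′ for j′ : Fin ⌈ n / p ⌉.
subsample : (p : ℕ) .{{_ : NonZero p}} → Vec A n → Vec A ⌈ n / p ⌉
subsample {n = n} p@(suc q) x = tabulate λ j′ → entry x (suc (p * toℕ j′)) (bound j′)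
  where
  bound : (j′ : Fin ⌈ n / p ⌉) → p * toℕ j′ < n
  bound j′ = +-cancelʳ-≤ q (suc (p * toℕ j′)) n (begin
    suc (p * toℕ j′) + q  ≡⟨ sym (+-suc (p * toℕ j′) q) ⟩
    p * toℕ j′ + p        ≡⟨ +-comm (p * toℕ j′) p ⟩
    p + p * toℕ j′        ≡⟨ sym (*-suc p (toℕ j′)) ⟩
    p * suc (toℕ j′)      ≤⟨ *-monoʳ-≤ p (toℕ<n j′) ⟩
    p * ⌈ n / p ⌉         ≡⟨ *-comm p ⌈ n / p ⌉ ⟩
    ⌈ n / p ⌉ * p         ≤⟨ m/n*n≤m (n + q) p ⟩
    n + q                 ∎)
    where open ≤-Reasoning

module _ {A : Set a} (_≟A_ : DecidableEquality A) where

  -- runLengthsFrom c r xs: the current block consists so far of r copies of c.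
  runLengthsFrom : A → ℕ → List A → List ℕ
  runLengthsFrom c r []       = r ∷ []
  runLengthsFrom c r (x ∷ xs) with c ≟A x
  ... | yes _ = runLengthsFrom c (suc r) xs
  ... | no  _ = r ∷ runLengthsFrom x 1 xs

  runLengthEncoding : List A → List ℕ
  runLengthEncoding []       = []
  runLengthEncoding (x ∷ xs) = runLengthsFrom x 1 xs

module Submission where

-- The run lengths together with x₁ = 1 determine the first 33 entries, so x is
-- a concrete prefix followed by an arbitrary tail.  Every claim concerns only
-- that prefix and is settled by computation.

open import Defs
open import Data.Fin using (Fin; toℕ; inject≤; zero; suc)
open import Data.Fin.Properties using (all?; toℕ-inject≤)
open import Data.Integer using (ℤ; +_; 1ℤ; -1ℤ; -_)
open import Data.Integer.Properties using (_≟_)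
open import Data.List using (List; []; _∷_; _++_; length; replicate; take)
import Data.List as List
open import Data.List.Properties using (∷-injective; tabulate-cong)
open import Data.List.Relation.Unary.All using (All; []; _∷_)
open import Data.List.Relation.Unary.All.Properties using (take⁺)
open import Data.Nat using (ℕ; suc; NonZero; s≤s; s≤s⁻¹; _+_; _*_; _≤_; _<_; _>_; >-nonZero; _≤?_)
open import Data.Nat.DivMod using (/-monoˡ-≤)
open import Data.Nat.Properties using (≤-trans; <⇒≤; m≤m+n; +-monoˡ-≤; *-monoʳ-≤; ≤-<-trans)
open import Data.Product using (_×_; _,_; ∃; Σ-syntax)
open import Data.Rational using (_/_) renaming (_≤_ to _≤ℚ_)
import Data.Rational.Properties as ℚₚ
open import Data.Sum using (_⊎_; inj₁; inj₂)
open import Data.Vec using (Vec; toList; fromList; tabulate; []; _∷_)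
import Data.Vec as Vec
import Data.Vec.Relation.Unary.All.Properties as VecAllₚ
open import Function using (_∘_)
open import Level using (Level)
open import Relation.Binary.PropositionalEquality using (_≡_; _≢_; refl; sym; trans; cong)
open import Relation.Nullary using (¬_; contradiction; yes; no)
open import Relation.Nullary.Decidable using (from-yes)

private
  variable
    a : Level
    A : Set a
    m n : ℕ

replicate-++-∷ : ∀ r (c : A) xs → replicate r c ++ c ∷ xs ≡ replicate (suc r) c ++ xs
replicate-++-∷ 0       c xs = refl
replicate-++-∷ (suc r) c xs = cong (c ∷_) (replicate-++-∷ r c xs)

Sign : ℤ → Set
Sign v = (v ≡ -1ℤ) ⊎ (v ≡ 1ℤ)

≢⇒≡- : ∀ {u v} → Sign u → Sign v → u ≢ v → v ≡ - u
≢⇒≡- (inj₁ refl) (inj₁ refl) u≢v = contradiction refl u≢v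
≢⇒≡- (inj₁ refl) (inj₂ refl) u≢v = refl
≢⇒≡- (inj₂ refl) (inj₁ refl) u≢v = refl
≢⇒≡- (inj₂ refl) (inj₂ refl) u≢v = contradiction refl u≢v

-- Decoder for run lengths: with only two signs available, the sign of the first block fixes the
-- signs of all later ones.
alternatingRuns : ℤ → List ℕ → List ℤ
alternatingRuns c []       = []
alternatingRuns c (r ∷ rs) = replicate r c ++ alternatingRuns (- c) rs

-- Induction on `xs` with `r` general: the accumulator stands for `r` copies of `c` already
-- consumed, so decoding must give them back in front of `xs`.
alternatingRuns-runLengthsFrom : ∀ {c} → Sign c → ∀ r {xs} → All Sign xs →
  alternatingRuns c (runLengthsFrom _≟_ c r xs) ≡ replicate r c ++ xs
alternatingRuns-runLengthsFrom c± r [] = refl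
alternatingRuns-runLengthsFrom {c} c± r {x ∷ xs} (x± ∷ xs±) with c ≟ x
... | yes refl = trans (alternatingRuns-runLengthsFrom c± (suc r) xs±)
                       (sym (replicate-++-∷ r c xs))
-- A sign different from `c` is `- c`, exactly the sign with which the decoder opens the next block.
... | no c≢x rewrite sym (≢⇒≡- c± x± c≢x) =
  cong (replicate r c ++_) (alternatingRuns-runLengthsFrom x± 1 xs±)

alternatingRuns-runLengthEncoding : ∀ {x xs} → All Sign (x ∷ xs) →
  alternatingRuns x (runLengthEncoding _≟_ (x ∷ xs)) ≡ x ∷ xs
alternatingRuns-runLengthEncoding (x± ∷ xs±) = alternatingRuns-runLengthsFrom x± 1 xs±

-- The equation is between pairs because the length of the vector is only
-- propositionally of the form length l + m; matching on refl substitutes both.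
take≡⇒prefix : (l : List A) (x : Vec A n) → take (length l) (toList x) ≡ l →
  ∃ λ m → Σ[ y ∈ Vec A m ] _≡_ {A = ∃ (Vec A)} (n , x) (length l + m , fromList l Vec.++ y)
take≡⇒prefix []      x       eq = _ , x , refl
take≡⇒prefix (c ∷ l) []      ()
take≡⇒prefix (c ∷ l) (v ∷ x) eq with ∷-injective eq
... | refl , eq′ with take≡⇒prefix l x eq′
...   | m , y , refl = m , y , refl

take-toList-tabulate : ∀ (f : Fin n → A) (m≤n : m ≤ n) →
  take m (toList (tabulate f)) ≡ List.tabulate (λ i → f (inject≤ i m≤n))
take-toList-tabulate {m = 0}                 f m≤n = refl
take-toList-tabulate {n = suc _} {m = suc _} f m≤n =
  cong (f zero ∷_) (take-toList-tabulate (f ∘ suc) (s≤s⁻¹ m≤n))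

entry-cong : ∀ (x : Vec A n) {i j} → i ≡ j → .(i<n : i < n) .(j<n : j < n) →
  entry x (suc i) i<n ≡ entry x (suc j) j<n
entry-cong x refl _ _ = refl

-- The right side is indexed by `Fin m` instead of `Fin ⌈ n / p ⌉`, so for a numeral `m` it
-- evaluates even when `n` contains a variable.
take-subsample : ∀ p .{{_ : NonZero p}} (x : Vec A n) → m ≤ ⌈ n / p ⌉ →
  (p*i<n : ∀ (i : Fin m) → p * toℕ i < n) →
  take m (toList (subsample p x)) ≡ List.tabulate (λ i → entry x (suc (p * toℕ i)) (p*i<n i))
take-subsample p@(suc _) x m≤ p*i<n = trans
  (take-toList-tabulate _ m≤)
  (tabulate-cong λ i → entry-cong x (cong (p *_) (toℕ-inject≤ i m≤)) _ (p*i<n i))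

prefix : List ℤ
prefix = alternatingRuns 1ℤ (5 ∷ 5 ∷ 10 ∷ 5 ∷ 4 ∷ 4 ∷ [])

samples : List ℤ
samples = 1ℤ ∷ -1ℤ ∷ 1ℤ ∷ 1ℤ ∷ -1ℤ ∷ 1ℤ ∷ -1ℤ ∷ []

take33≡prefix : ∀ (n>33 : n > 33) (x : Vec ℤ n) → Binary x →
  entry x 1 (≤-trans (m≤m+n 1 33) n>33) ≡ 1ℤ →
  runLengthEncoding _≟_ (take 33 (toList x)) ≡ 5 ∷ 5 ∷ 10 ∷ 5 ∷ 4 ∷ 4 ∷ [] →
  take 33 (toList x) ≡ prefix
-- Exposing the head of `x` lets `refl` set it to `1ℤ`, the sign from which `prefix` is decoded.
take33≡prefix n>33 (_ ∷ _) x± refl rle = trans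
  (sym (alternatingRuns-runLengthEncoding (take⁺ 33 (VecAllₚ.toList⁺ x±))))
  (cong (alternatingRuns 1ℤ) rle)

-- Equation (k) reads no entry past position 2k + 1 ≤ 2·16 + 1 = 33, so it never reaches `y`. Once
-- `k` is a numeral, both sides evaluate to the same rational.
prefix-satisfies : (y : Vec ℤ m) → ∀ k → 1 ≤ k → k ≤ 16 → .(h : 2 * k + 1 ≤ 33 + m) →
  SatisfiesEquation (fromList prefix Vec.++ y) k h
prefix-satisfies y 1  _ _ _ = refl
prefix-satisfies y 2  _ _ _ = refl
prefix-satisfies y 3  _ _ _ = refl
prefix-satisfies y 4  _ _ _ = refl
prefix-satisfies y 5  _ _ _ = refl
prefix-satisfies y 6  _ _ _ = refl
prefix-satisfies y 7  _ _ _ = refl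
prefix-satisfies y 8  _ _ _ = refl
prefix-satisfies y 9  _ _ _ = refl
prefix-satisfies y 10 _ _ _ = refl
prefix-satisfies y 11 _ _ _ = refl
prefix-satisfies y 12 _ _ _ = refl
prefix-satisfies y 13 _ _ _ = refl
prefix-satisfies y 14 _ _ _ = refl
prefix-satisfies y 15 _ _ _ = refl
prefix-satisfies y 16 _ _ _ = refl
prefix-satisfies y (suc (suc (suc (suc (suc (suc (suc (suc (suc (suc (suc (suc (suc (suc (suc (suc (suc _))))))))))))))))) _
  (s≤s (s≤s (s≤s (s≤s (s≤s (s≤s (s≤s (s≤s (s≤s (s≤s (s≤s (s≤s (s≤s (s≤s (s≤s (s≤s ())))))))))))))))) _

-- The left side is (1 + 1)/2 = 1, while the sum is z₁z₇ - z₂z₆ + z₃z₅ = -1 + 1 - 1 = -1.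
samples-violate : (z : Vec ℤ m) → take 7 (toList z) ≡ samples → .(7≤m : 7 ≤ m) →
  ¬ SatisfiesEquation z 3 7≤m
samples-violate z eq 7≤m with take≡⇒prefix samples z eq
... | _ , _ , refl = λ ()

7≤⌈n/5⌉ : n > 33 → 7 ≤ ⌈ n / 5 ⌉
-- Rounding up adds 5 - 1 = 4 before dividing, and 33 + 4 = 37 divided by 5 rounds down to 7.
7≤⌈n/5⌉ n>33 = /-monoˡ-≤ 5 (+-monoˡ-≤ 4 (<⇒≤ n>33))

module _ {n} (x : Vec ℤ n) (take≡prefix : take 33 (toList x) ≡ prefix) where

  take-samples : n > 33 → take 7 (toList (subsample 5 x)) ≡ samples
  take-samples n>33 with take≡⇒prefix prefix x take≡prefix
  ... | m , y , refl = take-subsample 5 x (7≤⌈n/5⌉ n>33) λ i →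
    -- The last sampled position is 5·6 + 1 = 31, so all seven lie in the known prefix.
    ≤-trans (from-yes (all? λ (i : Fin 7) → suc (5 * toℕ i) ≤? 33) i) (m≤m+n 33 m)

  first-run : ∀ i (1≤i : 1 ≤ i) (i≤5 : i ≤ 5) .(i≤n : i ≤ n) →
    entry x i {{>-nonZero 1≤i}} i≤n ≡ 1ℤ
  -- With `x` replaced by `prefix` and a tail, the lookup computes as soon as `i` is a numeral.
  first-run i 1≤i i≤5 i≤n with take≡⇒prefix prefix x take≡prefix
  first-run 1 _ _ _ | _ , _ , refl = refl
  first-run 2 _ _ _ | _ , _ , refl = refl
  first-run 3 _ _ _ | _ , _ , refl = refl
  first-run 4 _ _ _ | _ , _ , refl = refl
  first-run 5 _ _ _ | _ , _ , refl = refl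
  first-run (suc (suc (suc (suc (suc (suc _)))))) _ (s≤s (s≤s (s≤s (s≤s (s≤s ()))))) _ | _

  second-run : .(6≤n : 6 ≤ n) → entry x 6 6≤n ≡ -1ℤ
  second-run _ with take≡⇒prefix prefix x take≡prefix
  ... | _ , _ , refl = refl

  satisfies : ∀ k → 1 ≤ k → k ≤ 16 → .(2k+1≤n : 2 * k + 1 ≤ n) → SatisfiesEquation x k 2k+1≤n
  satisfies k 1≤k k≤16 2k+1≤n with take≡⇒prefix prefix x take≡prefix
  ... | _ , y , refl = prefix-satisfies y k 1≤k k≤16 2k+1≤n

mainTheorem2 :
    (n : ℕ) (n>33 : n > 33) (x : Vec ℤ n) →
    Binary x →
    entry x 1 (≤-trans (m≤m+n 1 33) n>33) ≡ 1ℤ →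
    runLengthEncoding _≟_ (take 33 (toList x)) ≡ 5 ∷ 5 ∷ 10 ∷ 5 ∷ 4 ∷ 4 ∷ [] →
    let p = 5
        t = 16
        z = subsample p x
    in
    (take 7 (toList z) ≡ 1ℤ ∷ -1ℤ ∷ 1ℤ ∷ 1ℤ ∷ -1ℤ ∷ 1ℤ ∷ -1ℤ ∷ []) ×
    (∀ i (1≤i : 1 ≤ i) (i≤p : i ≤ p) →
      entry x i {{>-nonZero 1≤i}} (≤-trans i≤p (≤-trans (m≤m+n 5 29) n>33)) ≡ 1ℤ) ×
    (entry x (p + 1) (≤-trans (m≤m+n 6 28) n>33) ≡ -1ℤ) ×
    (∀ k → 1 ≤ k → k ≤ t →
      Σ[ 2k+1<n ∈ 2 * k + 1 < n ] SatisfiesEquation x k (<⇒≤ 2k+1<n)) ×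
    (Σ[ 2k+1≤ ∈ 2 * 3 + 1 ≤ ⌈ n / p ⌉ ] ¬ SatisfiesEquation z 3 2k+1≤) ×
    ((+ 3 / 1) ≤ℚ (+ t / p)) ×
    (+ t / p ≡ + 32 / 10)
mainTheorem2 n n>33 x x± x₁≡1 rle =
    take-samples x eq n>33
  , (λ i 1≤i i≤5 → first-run x eq i 1≤i i≤5 _)
  , second-run x eq _
  , (λ k 1≤k k≤16 →
      -- The extreme case `k` = 16 gives 2·16 + 1 = 33, where `n>33` is just enough.
      let 2k+1<n = ≤-<-trans (+-monoˡ-≤ 1 (*-monoʳ-≤ 2 k≤16)) n>33
      in 2k+1<n , satisfies x eq k 1≤k k≤16 (<⇒≤ 2k+1<n))
  , (7≤⌈n/5⌉ n>33 , samples-violate (subsample 5 x) (take-samples x eq n>33) (7≤⌈n/5⌉ n>33))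
  , from-yes (+ 3 / 1 ℚₚ.≤? + 16 / 5)
  , refl
  where
  eq : take 33 (toList x) ≡ prefix
  eq = take33≡prefix n>33 x x± x₁≡1 rle
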